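{- Let $\star\in\{\boxtimes,\circ,\times\}$, $k$ a positive integer, and $G,H$ graphs. Then $m_k(G\star H)$ is $\ast$-well-behaved w.r.t. $G$ and $H$ if and only if there exist positive integers $k_G,k_H$ with $k_Gk_H=k$ such that $m_k(G\star H)=2\,m_{k_G}(G)\,m_{k_H}(H)$.
   Context: Graphs are finite, simple, undirected, with non-empty vertex set. For a positive integer $k$, a $k$-matching of $G=(V,E)$ is a set $M\subseteq E$ such that every vertex is incident to either $0$ or exactly $k$ edges of $M$ (the empty set is one); $m_k(G)$ is the maximum size of a $k$-matching of $G$. Products on $V_G\times V_H$: in $G\boxtimes H$, $(g,h)\sim(g',h')$ iff (i) $\{g,g'\}\in E_G$, $h=h'$; or (ii) $g=g'$, $\{h,h'\}\in E_H$; or (iii) $\{g,g'\}\in E_G$ and $\{h,h'\}\in E_H$; in $G\times H$ iff (iii); in $G\circ H$ iff $\{g,g'\}\in E_G$ or (ii). For $M_G\subseteq E_G$, $M_H\subseteq E_H$ define $F_{\ast}(M_G,M_H)=\{\{(g,h),(g',h')\}:\{g,g'\}\in M_G,\{h,h'\}\in M_H\}$. $m_k(G\star H)$ is $\ast$-well-behaved w.r.t. $G$ and $H$ if $m_k(G\star H)=|F_{\ast}(M_G,M_H)|$ for some $M_G\subseteq E_G$, $M_H\subseteq E_H$ for which $F_{\ast}(M_G,M_H)$ is a $k$-matching of $G\star H$. -}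

module Defs where

open import Data.Bool.Base using (Bool; true; false; _∧_; _∨_; T)
open import Data.Bool.Properties using (T-∧; T?; ∧-identityʳ; ∧-zeroʳ; ∨-comm; ∨-idem)
open import Data.Fin.Base using (Fin; combine; finToFun; funToFin)
import Data.Fin.Base as Fin
open import Data.Fin.Properties using (*↔×; 2↔Bool; all?; finToFun-funToFin)
import Data.Fin.Properties as Fin
open import Data.List.Base using (List; allFin; cartesianProduct; filter; filterᵇ; length; map)
open import Data.List.Extrema.Nat using (max; xs≤max; argmax-sel)
open import Data.List.Membership.Propositional using (_∈_)
open import Data.List.Membership.Propositional.Properties using (∈-map⁺; ∈-map⁻; ∈-filter⁺; ∈-filter⁻; ∈-allFin)
open import Data.List.Properties using (filter-≐; filter-none)
import Data.List.Relation.Unary.All as All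
open import Data.Nat.Base using (ℕ; NonZero; _*_; _^_; _≤_)
open import Data.Nat.Properties using (m*n≢0)
import Data.Nat.Properties as ℕ
open import Data.Product.Base using (_×_; _,_; proj₁; proj₂; Σ-syntax; ∃-syntax)
open import Data.Product.Function.NonDependent.Propositional using (_×-↔_)
open import Data.Sum.Base using (_⊎_; inj₁; inj₂)
open import Function.Base using (id; _∘_)
open import Function.Bundles using (_↔_; Inverse; Equivalence; mk⇔)
open import Function.Construct.Composition using (_↔-∘_)
open import Function.Construct.Symmetry using (↔-sym)
open import Function.Properties.Inverse using (↔⇒↣)
open import Level using (0ℓ)
open import Relation.Binary.Core using (Rel)
open import Relation.Binary.Definitions using (Decidable; Symmetric; Irreflexive; DecidableEquality)
open import Relation.Binary.PropositionalEquality
open import Relation.Nullary using (Dec; yes; does)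
open import Relation.Nullary.Decidable using (_×-dec_; _⊎-dec_; map′; does-⇔; via-injection; dec-true)

record Graph : Set₁ where
  field
    V        : Set
    order    : ℕ
    index    : V ↔ Fin order
    nonEmpty : NonZero order
    Adj      : Rel V 0ℓ
    adj?     : Decidable Adj
    adj-sym  : Symmetric Adj
    adj-irr  : Irreflexive _≡_ Adj

  toFin : V → Fin order
  toFin = Inverse.to index

  fromFin : Fin order → V
  fromFin = Inverse.from index

  vertices : List V
  vertices = map fromFin (allFin order)

  vertexPairs : List (V × V)
  vertexPairs = cartesianProduct vertices vertices

  _≟V_ : DecidableEquality V
  _≟V_ = via-injection (↔⇒↣ index) Fin._≟_

open Graph

-- A set M ⊆ E is given by its characteristic function on pairs of vertices:
-- mem u v is true precisely when {u , v} ∈ M.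
record EdgeSet (G : Graph) : Set where
  field
    mem     : V G → V G → Bool
    mem-sym : ∀ u v → mem u v ≡ mem v u
    mem⇒adj : ∀ {u v} → T (mem u v) → Adj G u v

open EdgeSet

module _ {G : Graph} where

  -- As G has no loops, the edges of M at v correspond to the w with {v , w} ∈ M.
  degree : EdgeSet G → V G → ℕ
  degree M v = length (filterᵇ (mem M v) (vertices G))

  -- Each unordered pair {u , v} is counted once, in the order of the indices.
  InOrder : EdgeSet G → V G × V G → Set
  InOrder M (u , v) = toFin G u Fin.< toFin G v × T (mem M u v)

  inOrder? : ∀ M p → Dec (InOrder M p)
  inOrder? M (u , v) = (toFin G u Fin.<? toFin G v) ×-dec T? (mem M u v)

  size : EdgeSet G → ℕ
  size M = length (filter (inOrder? M) (vertexPairs G))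

  IsMatching : ℕ → EdgeSet G → Set
  IsMatching k M = ∀ v → degree M v ≡ 0 ⊎ degree M v ≡ k

  isMatching? : ∀ k M → Dec (IsMatching k M)
  isMatching? k M = map′
    (λ p v → subst P (Inverse.strictlyInverseʳ (index G) v) (p (toFin G v)))
    (λ p i → p (fromFin G i))
    (all? λ i → (degree M (fromFin G i) ℕ.≟ 0) ⊎-dec (degree M (fromFin G i) ℕ.≟ k))
    where
    P : V G → Set
    P v = degree M v ≡ 0 ⊎ degree M v ≡ k

T-does : {A : Set} (a? : Dec A) → T (does a?) → A
T-does (yes a) _ = a

-- The edges {u , v} of G with b u v or b v u.
edgesOf : (G : Graph) → (V G → V G → Bool) → EdgeSet G
edgesOf G b = record
  { mem     = λ u v → does (adj? G u v) ∧ (b u v ∨ b v u)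
  ; mem-sym = λ u v → cong₂ _∧_
      (does-⇔ (mk⇔ (adj-sym G) (adj-sym G)) (adj? G u v) (adj? G v u))
      (∨-comm (b u v) (b v u))
  ; mem⇒adj = λ {u} {v} p → T-does (adj? G u v) (proj₁ (Equivalence.to T-∧ p))
  }

-- The n × n Boolean matrices are coded by Fin (2 ^ (n * n)).
decode : (G : Graph) → Fin (2 ^ (order G * order G)) → V G → V G → Bool
decode G c u v = Inverse.to 2↔Bool (finToFun c (combine (toFin G u) (toFin G v)))

-- Every edge set occurs here up to pointwise equality, possibly several times.
allEdgeSets : (G : Graph) → List (EdgeSet G)
allEdgeSets G = map (edgesOf G ∘ decode G) (allFin (2 ^ (order G * order G)))

-- By size≤m and m-attained below, this is the largest size of a k-matching of G.
m : ℕ → Graph → ℕ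
m k G = max 0 (map size (filter (isMatching? k) (allEdgeSets G)))

module _ {G : Graph} where

  degree-cong : (M N : EdgeSet G) → (∀ u v → mem M u v ≡ mem N u v) →
                ∀ v → degree M v ≡ degree N v
  degree-cong M N eq v = cong length (filter-≐ (T? ∘ mem M v) (T? ∘ mem N v)
    ((λ {w} → subst T (eq v w)) , (λ {w} → subst T (sym (eq v w)))) (vertices G))

  size-cong : (M N : EdgeSet G) → (∀ u v → mem M u v ≡ mem N u v) → size M ≡ size N
  size-cong M N eq = cong length (filter-≐ (inOrder? M) (inOrder? N)
    ( (λ { {u , v} (lt , p) → lt , subst T (eq u v) p })
    , (λ { {u , v} (lt , p) → lt , subst T (sym (eq u v)) p })) (vertexPairs G))

  allEdgeSets-complete : (M : EdgeSet G) →
    ∃[ N ] N ∈ allEdgeSets G × (∀ u v → mem M u v ≡ mem N u v)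
  allEdgeSets-complete M = N , ∈-map⁺ (edgesOf G ∘ decode G) (∈-allFin c) , mem≡
    where
    n = order G

    bit : Fin n × Fin n → Fin 2
    bit (i , j) = Inverse.from 2↔Bool (mem M (fromFin G i) (fromFin G j))

    c : Fin (2 ^ (n * n))
    c = funToFin (bit ∘ Inverse.to (*↔× {n} {n}))

    N : EdgeSet G
    N = edgesOf G (decode G c)

    decode-c : ∀ u v → decode G c u v ≡ mem M u v
    decode-c u v = begin
      Inverse.to 2↔Bool (finToFun c (combine i j))
        ≡⟨ cong (Inverse.to 2↔Bool) (finToFun-funToFin (bit ∘ Inverse.to (*↔× {n} {n})) (combine i j)) ⟩
      Inverse.to 2↔Bool (bit (Inverse.to (*↔× {n} {n}) (combine i j)))
        ≡⟨ cong (Inverse.to 2↔Bool ∘ bit) (Fin.remQuot-combine i j) ⟩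
      Inverse.to 2↔Bool (bit (i , j))
        ≡⟨ Inverse.strictlyInverseˡ 2↔Bool _ ⟩
      mem M (fromFin G i) (fromFin G j)
        ≡⟨ cong₂ (mem M) (Inverse.strictlyInverseʳ (index G) u) (Inverse.strictlyInverseʳ (index G) v) ⟩
      mem M u v ∎
      where
      open ≡-Reasoning
      i = toFin G u
      j = toFin G v

    absorb : ∀ {A : Set} (a? : Dec A) b → (T b → A) → b ≡ does a? ∧ b
    absorb a? false f = sym (∧-zeroʳ (does a?))
    absorb a? true  f = sym (trans (∧-identityʳ (does a?)) (dec-true a? (f _)))

    mem≡ : ∀ u v → mem M u v ≡ mem N u v
    mem≡ u v = trans (absorb (adj? G u v) (mem M u v) (mem⇒adj M))
      (cong (does (adj? G u v) ∧_) (sym (trans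
        (cong₂ _∨_ (decode-c u v) (trans (decode-c v u) (mem-sym M v u)))
        (∨-idem (mem M u v)))))

  size≤m : ∀ k (M : EdgeSet G) → IsMatching k M → size M ≤ m k G
  size≤m k M isM with N , N∈ , eq ← allEdgeSets-complete M =
    subst (_≤ m k G) (sym (size-cong M N eq))
      (All.lookup (xs≤max 0 _) (∈-map⁺ size (∈-filter⁺ (isMatching? k) N∈
        λ v → subst (λ d → d ≡ 0 ⊎ d ≡ k) (degree-cong M N eq v) (isM v))))

  ∅ : EdgeSet G
  ∅ = record { mem = λ _ _ → false ; mem-sym = λ _ _ → refl ; mem⇒adj = λ () }

  ∅-matching : ∀ k → IsMatching k ∅
  ∅-matching k v = inj₁ (cong length
    (filter-none (T? ∘ mem ∅ v) (All.universal (λ _ ()) (vertices G))))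

  size-∅ : size ∅ ≡ 0
  size-∅ = cong length (filter-none (inOrder? ∅) (All.universal (λ { _ (_ , ()) }) (vertexPairs G)))

  m-attained : ∀ k → ∃[ M ] IsMatching {G} k M × size M ≡ m k G
  m-attained k with argmax-sel id 0 (map size (filter (isMatching? k) (allEdgeSets G)))
  ... | inj₁ m≡0 = ∅ , ∅-matching k , trans size-∅ (sym m≡0)
  ... | inj₂ m∈  with M , M∈ , eq ← ∈-map⁻ size m∈ =
    M , proj₂ (∈-filter⁻ (isMatching? k) {xs = allEdgeSets G} M∈) , sym eq

data Product : Set where
  ⊠ ∘ˡ ×ᵈ : Product   -- strong, lexicographic, direct

module _ (G H : Graph) where

  ProductAdj : Product → Rel (V G × V H) 0ℓ
  ProductAdj ⊠  (g , h) (g′ , h′) = (Adj G g g′ × h ≡ h′) ⊎ (g ≡ g′ × Adj H h h′) ⊎ (Adj G g g′ × Adj H h h′)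
  ProductAdj ∘ˡ (g , h) (g′ , h′) = Adj G g g′ ⊎ (g ≡ g′ × Adj H h h′)
  ProductAdj ×ᵈ (g , h) (g′ , h′) = Adj G g g′ × Adj H h h′

  productAdj? : ∀ ⋆ → Decidable (ProductAdj ⋆)
  productAdj? ⊠  (g , h) (g′ , h′) = (adj? G g g′ ×-dec _≟V_ H h h′) ⊎-dec (_≟V_ G g g′ ×-dec adj? H h h′) ⊎-dec (adj? G g g′ ×-dec adj? H h h′)
  productAdj? ∘ˡ (g , h) (g′ , h′) = adj? G g g′ ⊎-dec (_≟V_ G g g′ ×-dec adj? H h h′)
  productAdj? ×ᵈ (g , h) (g′ , h′) = adj? G g g′ ×-dec adj? H h h′

  productAdj-sym : ∀ ⋆ → Symmetric (ProductAdj ⋆)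
  productAdj-sym ⊠  (inj₁ (a , e))        = inj₁ (adj-sym G a , sym e)
  productAdj-sym ⊠  (inj₂ (inj₁ (e , b))) = inj₂ (inj₁ (sym e , adj-sym H b))
  productAdj-sym ⊠  (inj₂ (inj₂ (a , b))) = inj₂ (inj₂ (adj-sym G a , adj-sym H b))
  productAdj-sym ∘ˡ (inj₁ a)              = inj₁ (adj-sym G a)
  productAdj-sym ∘ˡ (inj₂ (e , b))        = inj₂ (sym e , adj-sym H b)
  productAdj-sym ×ᵈ (a , b)               = adj-sym G a , adj-sym H b

  productAdj-irr : ∀ ⋆ → Irreflexive _≡_ (ProductAdj ⋆)
  productAdj-irr ⊠  refl (inj₁ (a , _))        = adj-irr G refl a
  productAdj-irr ⊠  refl (inj₂ (inj₁ (_ , b))) = adj-irr H refl b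
  productAdj-irr ⊠  refl (inj₂ (inj₂ (a , _))) = adj-irr G refl a
  productAdj-irr ∘ˡ refl (inj₁ a)              = adj-irr G refl a
  productAdj-irr ∘ˡ refl (inj₂ (_ , b))        = adj-irr H refl b
  productAdj-irr ×ᵈ refl (a , _)               = adj-irr G refl a

_⟨_⟩_ : Graph → Product → Graph → Graph
G ⟨ ⋆ ⟩ H = record
  { V        = V G × V H
  ; order    = order G * order H
  ; index    = ↔-sym *↔× ↔-∘ (index G ×-↔ index H)
  ; nonEmpty = m*n≢0 (order G) (order H) {{nonEmpty G}} {{nonEmpty H}}
  ; Adj      = ProductAdj G H ⋆
  ; adj?     = productAdj? G H ⋆
  ; adj-sym  = productAdj-sym G H ⋆
  ; adj-irr  = productAdj-irr G H ⋆
  }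

direct⊆ : ∀ G H ⋆ {g g′ h h′} → Adj G g g′ → Adj H h h′ → Adj (G ⟨ ⋆ ⟩ H) (g , h) (g′ , h′)
direct⊆ G H ⊠  a b = inj₂ (inj₂ (a , b))
direct⊆ G H ∘ˡ a b = inj₁ a
direct⊆ G H ×ᵈ a b = a , b

F∗ : ∀ {G H} ⋆ → EdgeSet G → EdgeSet H → EdgeSet (G ⟨ ⋆ ⟩ H)
F∗ {G} {H} ⋆ M N = record
  { mem     = λ (g , h) (g′ , h′) → mem M g g′ ∧ mem N h h′
  ; mem-sym = λ (g , h) (g′ , h′) → cong₂ _∧_ (mem-sym M g g′) (mem-sym N h h′)
  ; mem⇒adj = λ p → let a , b = Equivalence.to T-∧ p in direct⊆ G H ⋆ (mem⇒adj M a) (mem⇒adj N b)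
  }

WellBehaved : ℕ → Product → Graph → Graph → Set
WellBehaved k ⋆ G H =
  Σ[ M ∈ EdgeSet G ] Σ[ N ∈ EdgeSet H ]
    IsMatching k (F∗ ⋆ M N) × m k (G ⟨ ⋆ ⟩ H) ≡ size (F∗ ⋆ M N)

{-# OPTIONS --safe #-}

-- The degree of (g , h) in F∗ M N is the product of the degrees of g in M and h in N.
-- Summing degrees and applying the handshake lemma gives |F∗ M N| = 2 |M| |N|, and a
-- kG-matching M and a kH-matching N give a (kG kH)-matching F∗ M N, so that always
-- 2 m kG G · m kH H ≤ m (kG kH) (G ⋆ H). Conversely, if F∗ M N is a non-empty k-matching,
-- then comparing with fixed vertices g₀ , h₀ of non-zero degree shows that all non-zero
-- degrees of M equal deg g₀, all those of N equal deg h₀, and deg g₀ · deg h₀ = k.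

module Submission where

open import Defs
open import Data.Bool.Base using (Bool; T; true; false; _∧_; if_then_else_)
open import Data.Bool.Properties using (T?)
import Data.Fin.Properties as Fin
open import Data.List.Base using (List; []; _∷_; _++_; cartesianProduct; filter; length; map)
open import Data.List.Membership.Propositional using (_∈_)
open import Data.List.Membership.Propositional.Properties using (∈-allFin; ∈-cartesianProduct⁺; ∈-map⁺)
open import Data.List.Membership.Propositional.Properties.WithK using (unique∧set⇒bag)
open import Data.List.Properties using (map-++; map-∘; map-cong)
open import Data.List.Relation.Binary.BagAndSetEquality using (∼bag⇒↭)
open import Data.List.Relation.Binary.Permutation.Propositional using (_↭_)
import Data.List.Relation.Binary.Permutation.Propositional.Properties as ↭
open import Data.List.Relation.Unary.Unique.Propositional using (Unique)
import Data.List.Relation.Unary.Unique.Propositional.Properties as Unique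
open import Data.Nat.Base using (ℕ; zero; suc; _+_; _*_; _≤_; _<_; >-nonZero; z≤n; z<s)
open import Data.Nat.ListAction using (sum)
open import Data.Nat.ListAction.Properties using (sum-++; sum-↭)
open import Data.Nat.Properties
open import Data.Nat.Solver using (module +-*-Solver)
open import Data.Product.Base using (_×_; _,_; ∃-syntax; swap)
open import Data.Sum.Base using (_⊎_; inj₁; inj₂)
open import Function.Base using (_∘_)
open import Function.Bundles using (_⇔_; mk⇔; Injection; Inverse)
open import Function.Properties.Inverse using (↔-sym; ↔⇒↣)
open import Relation.Binary.Definitions using (tri<; tri≈; tri>)
open import Relation.Binary.PropositionalEquality
open import Relation.Nullary using (yes; no; does; contradiction)
open import Relation.Nullary.Decidable using (dec-true; dec-false)
open import Relation.Unary using (Pred; Decidable)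

open Graph
open EdgeSet

private
  variable
    A B : Set

-- Sums over lists

∑ : List A → (A → ℕ) → ℕ
∑ xs f = sum (map f xs)

∑-cong : ∀ (xs : List A) {f g : A → ℕ} → f ≗ g → ∑ xs f ≡ ∑ xs g
∑-cong xs f≗g = cong sum (map-cong f≗g xs)

∑-↭ : ∀ {xs ys : List A} (f : A → ℕ) → xs ↭ ys → ∑ xs f ≡ ∑ ys f
∑-↭ f xs↭ys = sum-↭ (↭.map⁺ f xs↭ys)

∑-map : ∀ (g : A → B) (xs : List A) (f : B → ℕ) → ∑ (map g xs) f ≡ ∑ xs (f ∘ g)
∑-map g xs f = cong sum (sym (map-∘ xs))

∑-++ : ∀ (xs ys : List A) (f : A → ℕ) → ∑ (xs ++ ys) f ≡ ∑ xs f + ∑ ys f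
∑-++ xs ys f = trans (cong sum (map-++ f xs ys)) (sum-++ (map f xs) (map f ys))

∑-+ : ∀ (xs : List A) (f g : A → ℕ) → ∑ xs (λ x → f x + g x) ≡ ∑ xs f + ∑ xs g
∑-+ []       f g = refl
∑-+ (x ∷ xs) f g = trans (cong (f x + g x +_) (∑-+ xs f g))
  (solve 4 (λ a b c d → (a :+ b) :+ (c :+ d) := (a :+ c) :+ (b :+ d)) refl
    (f x) (g x) (∑ xs f) (∑ xs g))
  where open +-*-Solver

∑-*ˡ : ∀ c (xs : List A) (f : A → ℕ) → ∑ xs (λ x → c * f x) ≡ c * ∑ xs f
∑-*ˡ c []       f = sym (*-zeroʳ c)
∑-*ˡ c (x ∷ xs) f = trans (cong (c * f x +_) (∑-*ˡ c xs f)) (sym (*-distribˡ-+ c (f x) (∑ xs f)))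

∑-*ʳ : ∀ c (xs : List A) (f : A → ℕ) → ∑ xs (λ x → f x * c) ≡ ∑ xs f * c
∑-*ʳ c xs f = trans (∑-cong xs (λ x → *-comm (f x) c)) (trans (∑-*ˡ c xs f) (*-comm c _))

∑-cartesianProduct : ∀ (xs : List A) (ys : List B) (f : A × B → ℕ) →
  ∑ (cartesianProduct xs ys) f ≡ ∑ xs (λ x → ∑ ys (λ y → f (x , y)))
∑-cartesianProduct []       ys f = refl
∑-cartesianProduct (x ∷ xs) ys f = trans
  (∑-++ (map (x ,_) ys) (cartesianProduct xs ys) f)
  (cong₂ _+_ (∑-map (x ,_) ys f) (∑-cartesianProduct xs ys f))

∑-cartesianProduct-* : ∀ (xs : List A) (ys : List B) (f : A → ℕ) (g : B → ℕ) →
  ∑ (cartesianProduct xs ys) (λ (x , y) → f x * g y) ≡ ∑ xs f * ∑ ys g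
∑-cartesianProduct-* xs ys f g = trans
  (∑-cartesianProduct xs ys _)
  (trans (∑-cong xs (λ x → ∑-*ˡ (f x) ys g)) (∑-*ʳ (∑ ys g) xs f))

-- Applied to degrees, this separates the empty edge sets from those that supply a vertex with which
-- all other degrees can be compared.
∑≡0⊎positive-term : ∀ (xs : List A) (f : A → ℕ) → ∑ xs f ≡ 0 ⊎ (∃[ x ] 0 < f x)
∑≡0⊎positive-term []       f = inj₁ refl
∑≡0⊎positive-term (x ∷ xs) f with f x in fx≡
... | zero  = ∑≡0⊎positive-term xs f
... | suc _ = inj₂ (x , subst (0 <_) (sym fx≡) z<s)

indicator : Bool → ℕ
indicator b = if b then 1 else 0

indicator-∧ : ∀ a b → indicator (a ∧ b) ≡ indicator a * indicator b
indicator-∧ false b = refl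
indicator-∧ true  b = sym (*-identityˡ (indicator b))

-- Degrees and sizes are lengths of filtered lists; as sums of zeros and ones they can be reordered
-- and factored.
length-filter : ∀ {ℓ} {P : Pred A ℓ} (P? : Decidable P) (xs : List A) →
  length (filter P? xs) ≡ ∑ xs (indicator ∘ does ∘ P?)
length-filter P? []       = refl
length-filter P? (x ∷ xs) with does (P? x)
... | false = length-filter P? xs
... | true  = cong suc (length-filter P? xs)

-- Enumerations of the vertices and of the ordered pairs of vertices

-- In a list without repetitions every element occurs in just one position, so having the same
-- elements already means having the same multiplicities.
unique∧complete⇒↭ : ∀ {xs ys : List A} → Unique xs → Unique ys →
  (∀ x → x ∈ xs) → (∀ x → x ∈ ys) → xs ↭ ys
unique∧complete⇒↭ !xs !ys ∈xs ∈ys =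
  ∼bag⇒↭ (unique∧set⇒bag !xs !ys (λ {x} → mk⇔ (λ _ → ∈ys x) (λ _ → ∈xs x)))

vertices-unique : ∀ G → Unique (vertices G)
vertices-unique G =
  Unique.map⁺ (Injection.injective (↔⇒↣ (↔-sym (index G)))) (Unique.allFin⁺ (order G))

∈-vertices : ∀ G v → v ∈ vertices G
∈-vertices G v = subst (_∈ vertices G) (Inverse.strictlyInverseʳ (index G) v)
  (∈-map⁺ (fromFin G) (∈-allFin (toFin G v)))

-- Sums over the product graph thereby become double sums, with no computation in the index
-- bijection of the product.
vertices-product : ∀ G H ⋆ → vertices (G ⟨ ⋆ ⟩ H) ↭ cartesianProduct (vertices G) (vertices H)
vertices-product G H ⋆ = unique∧complete⇒↭
  (vertices-unique (G ⟨ ⋆ ⟩ H))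
  (Unique.cartesianProduct⁺ (vertices-unique G) (vertices-unique H))
  (∈-vertices (G ⟨ ⋆ ⟩ H))
  (λ (g , h) → ∈-cartesianProduct⁺ (∈-vertices G g) (∈-vertices H h))

vertexPairs-swap : ∀ G → map swap (vertexPairs G) ↭ vertexPairs G
vertexPairs-swap G = unique∧complete⇒↭
  (Unique.map⁺ (cong swap) !pairs) !pairs (λ p → ∈-map⁺ swap (∈pairs (swap p))) ∈pairs
  where
  !pairs : Unique (vertexPairs G)
  !pairs = Unique.cartesianProduct⁺ (vertices-unique G) (vertices-unique G)

  ∈pairs : ∀ p → p ∈ vertexPairs G
  ∈pairs (u , v) = ∈-cartesianProduct⁺ (∈-vertices G u) (∈-vertices G v)

-- Degrees and sizes

module _ {G : Graph} (M : EdgeSet G) where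

  degree-∑ : ∀ v → degree M v ≡ ∑ (vertices G) (indicator ∘ mem M v)
  degree-∑ v = length-filter (T? ∘ mem M v) (vertices G)

  size-∑ : size M ≡ ∑ (vertexPairs G) (indicator ∘ does ∘ inOrder? M)
  size-∑ = length-filter (inOrder? M) (vertexPairs G)

  -- The ends of an edge have distinct indices, so exactly one of its two orientations is in order.
  mem-orientations : ∀ u v → indicator (mem M u v) ≡
    indicator (does (inOrder? M (u , v))) + indicator (does (inOrder? M (v , u)))
  mem-orientations u v rewrite mem-sym M v u with mem M u v in uv∈M
  -- Each `does (inOrder? M _)` is now a conjunction with right factor `false`, which reduces only
  -- after its comparison is split.
  ... | false with does (toFin G u Fin.<? toFin G v) | does (toFin G v Fin.<? toFin G u)
  ...   | false | false = refl
  ...   | false | true  = refl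
  ...   | true  | false = refl
  ...   | true  | true  = refl
  mem-orientations u v | true with Fin.<-cmp (toFin G u) (toFin G v)
  ... | tri< u<v _ v≮u
    rewrite dec-true (toFin G u Fin.<? toFin G v) u<v | dec-false (toFin G v Fin.<? toFin G u) v≮u = refl
  ... | tri> u≮v _ v<u
    rewrite dec-false (toFin G u Fin.<? toFin G v) u≮v | dec-true (toFin G v Fin.<? toFin G u) v<u = refl
  -- Equal indices would make the edge a loop.
  ... | tri≈ _ u≡v _ = contradiction (mem⇒adj M (subst T (sym uv∈M) _))
    (adj-irr G (Injection.injective (↔⇒↣ (index G)) u≡v))

  -- The degree sum counts ordered pairs. Splitting it by orientation gives two sums, which agree
  -- because swapping permutes the list of all pairs.
  handshake : ∑ (vertices G) (degree M) ≡ 2 * size M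
  handshake = begin
    ∑ (vertices G) (degree M)
      ≡⟨ ∑-cong (vertices G) degree-∑ ⟩
    ∑ (vertices G) (λ u → ∑ (vertices G) (λ v → indicator (mem M u v)))
      ≡⟨ ∑-cartesianProduct (vertices G) (vertices G) (λ (u , v) → indicator (mem M u v)) ⟨
    ∑ (vertexPairs G) (λ (u , v) → indicator (mem M u v))
      ≡⟨ ∑-cong (vertexPairs G) (λ (u , v) → mem-orientations u v) ⟩
    ∑ (vertexPairs G) (λ p → ordered p + ordered (swap p))
      ≡⟨ ∑-+ (vertexPairs G) ordered (ordered ∘ swap) ⟩
    ∑ (vertexPairs G) ordered + ∑ (vertexPairs G) (ordered ∘ swap)
      ≡⟨ cong (∑ (vertexPairs G) ordered +_) (trans
           (sym (∑-map swap (vertexPairs G) ordered)) (∑-↭ ordered (vertexPairs-swap G))) ⟩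
    ∑ (vertexPairs G) ordered + ∑ (vertexPairs G) ordered
      ≡⟨ cong₂ _+_ size-∑ size-∑ ⟨
    size M + size M
      ≡⟨ cong (size M +_) (+-identityʳ (size M)) ⟨
    2 * size M ∎
    where
    open ≡-Reasoning
    ordered : V G × V G → ℕ
    ordered = indicator ∘ does ∘ inOrder? M

  ∑degree≡0⇒size≡0 : ∑ (vertices G) (degree M) ≡ 0 → size M ≡ 0
  ∑degree≡0⇒size≡0 ∑≡0 = *-cancelˡ-≡ (size M) 0 2 (trans (sym handshake) ∑≡0)

-- Degrees, size and matchings of `F∗ ⋆ M N`

module _ {G H : Graph} (⋆ : Product) (M : EdgeSet G) (N : EdgeSet H) where

  -- The indicator of a conjunction is a product, so the sum over pairs factors. The choice of `⋆`
  -- does not enter `mem` of `F∗ ⋆ M N`.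
  degree-F∗ : ∀ g h → degree (F∗ ⋆ M N) (g , h) ≡ degree M g * degree N h
  degree-F∗ g h = begin
    degree (F∗ ⋆ M N) (g , h)
      ≡⟨ degree-∑ (F∗ ⋆ M N) (g , h) ⟩
    ∑ (vertices (G ⟨ ⋆ ⟩ H)) (λ (g′ , h′) → indicator (mem M g g′ ∧ mem N h h′))
      ≡⟨ ∑-↭ _ (vertices-product G H ⋆) ⟩
    ∑ pairs (λ (g′ , h′) → indicator (mem M g g′ ∧ mem N h h′))
      ≡⟨ ∑-cong pairs (λ (g′ , h′) → indicator-∧ (mem M g g′) (mem N h h′)) ⟩
    ∑ pairs (λ (g′ , h′) → indicator (mem M g g′) * indicator (mem N h h′))
      ≡⟨ ∑-cartesianProduct-* (vertices G) (vertices H) (indicator ∘ mem M g) (indicator ∘ mem N h) ⟩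
    ∑ (vertices G) (indicator ∘ mem M g) * ∑ (vertices H) (indicator ∘ mem N h)
      ≡⟨ cong₂ _*_ (degree-∑ M g) (degree-∑ N h) ⟨
    degree M g * degree N h ∎
    where
    open ≡-Reasoning
    pairs : List (V G × V H)
    pairs = cartesianProduct (vertices G) (vertices H)

  -- Handshaking in all three graphs yields a factor 2 on the left and 4 on the right. The 2 that
  -- survives cancellation reflects the two ways to pair the ends of an edge of `M` with those of an
  -- edge of `N`.
  size-F∗ : size (F∗ ⋆ M N) ≡ 2 * size M * size N
  size-F∗ = *-cancelˡ-≡ _ _ 2 (begin
    2 * size (F∗ ⋆ M N)
      ≡⟨ handshake (F∗ ⋆ M N) ⟨
    ∑ (vertices (G ⟨ ⋆ ⟩ H)) (degree (F∗ ⋆ M N))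
      ≡⟨ ∑-↭ _ (vertices-product G H ⋆) ⟩
    ∑ (cartesianProduct (vertices G) (vertices H)) (degree (F∗ ⋆ M N))
      ≡⟨ ∑-cong (cartesianProduct (vertices G) (vertices H)) (λ (g , h) → degree-F∗ g h) ⟩
    ∑ (cartesianProduct (vertices G) (vertices H)) (λ (g , h) → degree M g * degree N h)
      ≡⟨ ∑-cartesianProduct-* (vertices G) (vertices H) (degree M) (degree N) ⟩
    ∑ (vertices G) (degree M) * ∑ (vertices H) (degree N)
      ≡⟨ cong₂ _*_ (handshake M) (handshake N) ⟩
    2 * size M * (2 * size N)
      ≡⟨ solve 2 (λ a b → con 2 :* a :* (con 2 :* b) := con 2 :* (con 2 :* a :* b)) refl (size M) (size N) ⟩
    2 * (2 * size M * size N) ∎)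
    where
    open ≡-Reasoning
    open +-*-Solver

  F∗-matching : ∀ {kG kH} → IsMatching kG M → IsMatching kH N → IsMatching (kG * kH) (F∗ ⋆ M N)
  F∗-matching M-matching N-matching (g , h) rewrite degree-F∗ g h
    with M-matching g | N-matching h
  ... | inj₁ dg≡0  | _          rewrite dg≡0 = inj₁ refl
  ... | inj₂ dg≡kG | inj₁ dh≡0  = inj₁ (trans (cong (degree M g *_) dh≡0) (*-zeroʳ (degree M g)))
  ... | inj₂ dg≡kG | inj₂ dh≡kH = inj₂ (cong₂ _*_ dg≡kG dh≡kH)

  module _ {k} (F-matching : IsMatching k (F∗ ⋆ M N)) where

    -- A product of positive numbers is not 0, which leaves only the second alternative of
    -- `IsMatching`.
    positive-degrees : ∀ {g h} → 0 < degree M g → 0 < degree N h → degree M g * degree N h ≡ k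
    positive-degrees {g} {h} 0<dg 0<dh with F-matching (g , h)
    ... | inj₂ d≡k = trans (sym (degree-F∗ g h)) d≡k
    ... | inj₁ d≡0 = contradiction (trans (sym (degree-F∗ g h)) d≡0) (>⇒≢ (*-mono-< 0<dg 0<dh))

    -- If `degree M g` is non-zero, then its product with `degree N h₀` is `k`, as for `g₀`; the
    -- common factor cancels.
    F∗-matchingˡ : ∀ {g₀ h₀} → 0 < degree M g₀ → 0 < degree N h₀ → IsMatching (degree M g₀) M
    F∗-matchingˡ {g₀} {h₀} 0<dg₀ 0<dh₀ g with degree M g ≟ 0
    ... | yes dg≡0 = inj₁ dg≡0
    ... | no  dg≢0 = inj₂ (*-cancelʳ-≡ (degree M g) (degree M g₀) (degree N h₀) {{>-nonZero 0<dh₀}}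
      (trans (positive-degrees (n≢0⇒n>0 dg≢0) 0<dh₀) (sym (positive-degrees 0<dg₀ 0<dh₀))))

    F∗-matchingʳ : ∀ {g₀ h₀} → 0 < degree M g₀ → 0 < degree N h₀ → IsMatching (degree N h₀) N
    F∗-matchingʳ {g₀} {h₀} 0<dg₀ 0<dh₀ h with degree N h ≟ 0
    ... | yes dh≡0 = inj₁ dh≡0
    ... | no  dh≢0 = inj₂ (*-cancelˡ-≡ (degree N h) (degree N h₀) (degree M g₀) {{>-nonZero 0<dg₀}}
      (trans (positive-degrees 0<dg₀ (n≢0⇒n>0 dh≢0)) (sym (positive-degrees 0<dg₀ 0<dh₀))))

-- Maximum matchings of products

2*m*m≤m : ∀ ⋆ G H kG kH → 2 * m kG G * m kH H ≤ m (kG * kH) (G ⟨ ⋆ ⟩ H)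
2*m*m≤m ⋆ G H kG kH
  with M , M-matching , sizeM ← m-attained {G} kG
     | N , N-matching , sizeN ← m-attained {H} kH
  -- For maximum matchings `M` and `N` the left side turns into the size of `F∗ ⋆ M N`.
  rewrite sym sizeM | sym sizeN | sym (size-F∗ ⋆ M N) =
  size≤m (kG * kH) (F∗ ⋆ M N) (F∗-matching ⋆ M N M-matching N-matching)

mainTheorem13 : (⋆ : Product) (k : ℕ) → 0 < k → (G H : Graph) →
    WellBehaved k ⋆ G H ⇔
    (∃[ kG ] ∃[ kH ] 0 < kG × 0 < kH × kG * kH ≡ k × m k (G ⟨ ⋆ ⟩ H) ≡ 2 * m kG G * m kH H)
mainTheorem13 ⋆ k 0<k G H = mk⇔ to from
  where
  Factorisation : Set
  Factorisation =
    ∃[ kG ] ∃[ kH ] 0 < kG × 0 < kH × kG * kH ≡ k × m k (G ⟨ ⋆ ⟩ H) ≡ 2 * m kG G * m kH H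

  -- Only the upper bound has to be supplied; the lower bound holds for every factorisation of `k`.
  factorisation : ∀ {kG kH} → 0 < kG → 0 < kH → kG * kH ≡ k →
    m k (G ⟨ ⋆ ⟩ H) ≤ 2 * m kG G * m kH H → Factorisation
  factorisation {kG} {kH} 0<kG 0<kH refl m≤ =
    kG , kH , 0<kG , 0<kH , refl , ≤-antisym m≤ (2*m*m≤m ⋆ G H kG kH)

  -- When the maximum is 0 the upper bound is immediate, so any factorisation will do; 1 times `k`
  -- always exists.
  trivial : m k (G ⟨ ⋆ ⟩ H) ≡ 0 → Factorisation
  trivial m≡0 = factorisation z<s 0<k (*-identityˡ k) (subst (_≤ 2 * m 1 G * m k H) (sym m≡0) z≤n)

  to : WellBehaved k ⋆ G H → Factorisation
  to (M , N , F-matching , m≡)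
    with ∑≡0⊎positive-term (vertices G) (degree M) | ∑≡0⊎positive-term (vertices H) (degree N)
  -- If either factor has no edges, neither has `F∗ ⋆ M N`, and its size is the maximum.
  ... | inj₁ ∑≡0 | _ = trivial (trans m≡ (trans (size-F∗ ⋆ M N)
    (cong (λ s → 2 * s * size N) (∑degree≡0⇒size≡0 M ∑≡0))))
  ... | inj₂ _ | inj₁ ∑≡0 = trivial (trans m≡ (trans (size-F∗ ⋆ M N)
    (trans (cong (2 * size M *_) (∑degree≡0⇒size≡0 N ∑≡0)) (*-zeroʳ (2 * size M)))))
  -- The factors of `k` are the degrees of `g₀` and `h₀`. `M` and `N` are matchings for them, so
  -- their sizes are bounded by the respective maxima.
  ... | inj₂ (g₀ , 0<dg₀) | inj₂ (h₀ , 0<dh₀) =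
    factorisation 0<dg₀ 0<dh₀ (positive-degrees ⋆ M N F-matching 0<dg₀ 0<dh₀)
      (≤-trans (≤-reflexive (trans m≡ (size-F∗ ⋆ M N)))
        (*-mono-≤
          (*-monoʳ-≤ 2 (size≤m _ M (F∗-matchingˡ ⋆ M N F-matching 0<dg₀ 0<dh₀)))
          (size≤m _ N (F∗-matchingʳ ⋆ M N F-matching 0<dg₀ 0<dh₀))))

  from : Factorisation → WellBehaved k ⋆ G H
  from (kG , kH , _ , _ , refl , m≡)
    with M , M-matching , sizeM ← m-attained {G} kG
       | N , N-matching , sizeN ← m-attained {H} kH =
    -- Maximum matchings of the two factors are the witnesses.
    M , N , F∗-matching ⋆ M N M-matching N-matching ,
    trans m≡ (sym (trans (size-F∗ ⋆ M N) (cong₂ (λ s t → 2 * s * t) sizeM sizeN)))
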